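{- Let $\mathcal{P}$ be a parametrised propositional logic program over a finite alphabet $\Sigma=\Sigma_p\cup\Sigma_d$. If the parametrised well-founded model of $\mathcal{P}$ is exact, i.e. of the form $(\mathcal{A},\mathcal{A})$ for some symbolic interpretation $\mathcal{A}\in L^d_p$, then for every $\Sigma$-interpretation $J$: $J\models_{wf}\mathcal{P}$ if and only if $J\models\mathrm{Th}(\mathcal{A})$.
   Context: A parametrised logic program is a finite set of rules $h\leftarrow l_1\wedge\dots\wedge l_n$ with $h\in\Sigma_d$ and each $l_i$ an atom of $\Sigma$ or its negation; $\varphi_q$ is the disjunction of bodies of rules with head $q$. $L_p$: equivalence classes of propositional formulas over $\Sigma_p$ ordered by entailment; $L^d_p$: maps $\Sigma_d\to L_p$ ordered pointwise. For $\mathcal{S}=(\mathcal{A}_t,\mathcal{A}_p)\in(L^d_p)^2$, $\varphi^{\mathcal{S}}$ is computed by substituting $(\overline q,\overline q)$ for $q\in\Sigma_p$ and $(\mathcal{A}_t(q),\mathcal{A}_p(q))$ for $q\in\Sigma_d$, with $\wedge,\vee$ componentwise and $(\neg\psi)^{\mathcal{S}}=(\overline{\neg\psi_p},\overline{\neg\psi_t})$. $\Psi_{\mathcal{P}}(\mathcal{S})(q)=\varphi_q^{\mathcal{S}}$ and $\mathcal{T}_{\mathcal{P}}(\mathcal{A})(q)=\varphi_q^{(\mathcal{A},\mathcal{A})}$ (common component). For an operator $B$ on $M^2$ (precision order $(x,y)\leq_p(u,v)$ iff $x\leq u,v\leq y$), a partial $B$-stable fixpoint is $(x,y)$ with $x=\mathrm{lfp}(B(\cdot,y)_1)$,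 $y=\mathrm{lfp}(B(x,\cdot)_2)$, and the $B$-well-founded fixpoint is the least precise one. The parametrised well-founded model of $\mathcal{P}$ is the $\Psi_{\mathcal{P}}$-well-founded fixpoint of $\mathcal{T}_{\mathcal{P}}$. $\mathrm{Th}(\mathcal{A})=\bigwedge_{q\in\Sigma_d}(q\leftrightarrow\psi_q)$ with $\psi_q$ a representative of $\mathcal{A}(q)$. For $I\in 2^{\Sigma_p}$, $T^I_{\mathcal{P}}$ is the immediate consequence operator on $2^{\Sigma_d}$ with $\Sigma_p$ fixed to $I$ and $\Psi^I_{\mathcal{P}}$ Fitting's three-valued operator on pairs of $\Sigma_d$-interpretations with $\Sigma_p$ fixed to $I$. $J\models_{wf}\mathcal{P}$ iff $(J\cap\Sigma_d,J\cap\Sigma_d)$ is the $\Psi^{J\cap\Sigma_p}_{\mathcal{P}}$-well-founded fixpoint of $T^{J\cap\Sigma_p}_{\mathcal{P}}$. -}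

module Defs where

open import Data.Bool.Base using (Bool; true; false; not; f≤t; b≤b) renaming (_∧_ to _∧ᵇ_; _∨_ to _∨ᵇ_; _≤_ to _≤ᵇ_)
open import Data.Bool.Properties using () renaming (≤-poset to Bool-poset)
open import Data.Fin.Base using (Fin)
open import Data.Fin.Properties using (_≟_)
open import Data.List.Base using (List; map; foldr; filter; allFin)
open import Data.Nat.Base using (ℕ)
open import Data.Product.Base using (_×_; _,_; proj₁; proj₂)
open import Data.Sum.Base using (_⊎_; inj₁; inj₂; [_,_]′)
open import Function.Base using (id; _∘_)
open import Level using (0ℓ; _⊔_)
open import Relation.Binary.Bundles using (Poset)
open import Relation.Binary.PropositionalEquality using (_≡_; refl; sym; cong; cong₂)

infixr 6 _∧_
infixr 5 _∨_
infix  4 _↔_ _⊨_ _⊩_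

-- The bilattice M² carries the precision order.  Least fixpoints and
-- well-founded fixpoints are predicates, so that "x = lfp f" is read
-- "x is the least fixpoint of f"; both are unique up to _≈_.
module AFT {c ℓ₁ ℓ₂} (M : Poset c ℓ₁ ℓ₂) where
  open Poset M using (Carrier; _≈_; _≤_)

  infix 4 _≤ₚ_

  _≤ₚ_ : Carrier × Carrier → Carrier × Carrier → Set ℓ₂
  (x , y) ≤ₚ (u , v) = x ≤ u × v ≤ y

  IsLfp : (Carrier → Carrier) → Carrier → Set (c ⊔ ℓ₁ ⊔ ℓ₂)
  IsLfp f x = f x ≈ x × (∀ z → f z ≈ z → x ≤ z)

  record Approximator (O : Carrier → Carrier) : Set (c ⊔ ℓ₁ ⊔ ℓ₂) where
    field
      apply    : Carrier × Carrier → Carrier × Carrier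
      monotone : ∀ {s s′} → s ≤ₚ s′ → apply s ≤ₚ apply s′
      exact    : ∀ x → proj₁ (apply (x , x)) ≈ O x × proj₂ (apply (x , x)) ≈ O x

  module _ {O : Carrier → Carrier} (B : Approximator O) where
    open Approximator B

    IsPartialStable : Carrier × Carrier → Set (c ⊔ ℓ₁ ⊔ ℓ₂)
    IsPartialStable (x , y) =
      IsLfp (λ z → proj₁ (apply (z , y))) x × IsLfp (λ z → proj₂ (apply (x , z))) y

    IsWellFounded : Carrier × Carrier → Set (c ⊔ ℓ₁ ⊔ ℓ₂)
    IsWellFounded s = IsPartialStable s × (∀ s′ → IsPartialStable s′ → s ≤ₚ s′)

pointwise : ∀ {a c ℓ₁ ℓ₂} → Set a → Poset c ℓ₁ ℓ₂ → Poset (a ⊔ c) (a ⊔ ℓ₁) (a ⊔ ℓ₂)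
pointwise X M = record
  { Carrier        = X → M.Carrier
  ; _≈_            = λ f g → ∀ x → f x M.≈ g x
  ; _≤_            = λ f g → ∀ x → f x M.≤ g x
  ; isPartialOrder = record
    { isPreorder = record
      { isEquivalence = record
        { refl  = λ x → M.Eq.refl
        ; sym   = λ p x → M.Eq.sym (p x)
        ; trans = λ p q x → M.Eq.trans (p x) (q x)
        }
      ; reflexive = λ p x → M.reflexive (p x)
      ; trans     = λ p q x → M.trans (p x) (q x)
      }
    ; antisym = λ p q x → M.antisym (p x) (q x)
    }
  } where module M = Poset M

data Formula (A : Set) : Set where
  var     : A → Formula A
  ⊤′ ⊥′   : Formula A
  ¬′_     : Formula A → Formula A
  _∧_ _∨_ : Formula A → Formula A → Formula A

_↔_ : ∀ {A} → Formula A → Formula A → Formula A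
φ ↔ ψ = (¬′ φ ∨ ψ) ∧ (¬′ ψ ∨ φ)

⋀ ⋁ : ∀ {A} → List (Formula A) → Formula A
⋀ = foldr _∧_ ⊤′
⋁ = foldr _∨_ ⊥′

rename : ∀ {A B} → (A → B) → Formula A → Formula B
rename f (var a) = var (f a)
rename f ⊤′      = ⊤′
rename f ⊥′      = ⊥′
rename f (¬′ φ)  = ¬′ rename f φ
rename f (φ ∧ ψ) = rename f φ ∧ rename f ψ
rename f (φ ∨ ψ) = rename f φ ∨ rename f ψ

-- An interpretation is the characteristic function of a set of atoms.
Interpretation : Set → Set
Interpretation A = A → Bool

eval : ∀ {A} → Interpretation A → Formula A → Bool
eval I (var a) = I a
eval I ⊤′      = true
eval I ⊥′      = false
eval I (¬′ φ)  = not (eval I φ)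
eval I (φ ∧ ψ) = eval I φ ∧ᵇ eval I ψ
eval I (φ ∨ ψ) = eval I φ ∨ᵇ eval I ψ

_⊨_ : ∀ {A} → Interpretation A → Formula A → Set
I ⊨ φ = eval I φ ≡ true

_⊩_ : ∀ {A} → Formula A → Formula A → Set
φ ⊩ ψ = ∀ I → I ⊨ φ → I ⊨ ψ

-- Formulas modulo logical equivalence: the quotient is the setoid
-- equality of the poset.
Lindenbaum : Set → Poset 0ℓ 0ℓ 0ℓ
Lindenbaum A = record
  { Carrier        = Formula A
  ; _≈_            = λ φ ψ → φ ⊩ ψ × ψ ⊩ φ
  ; _≤_            = _⊩_
  ; isPartialOrder = record
    { isPreorder = record
      { isEquivalence = record
        { refl  = (λ I → id) , (λ I → id)
        ; sym   = λ (p , q) → q , p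
        ; trans = λ (p , q) (r , s) → (λ I → r I ∘ p I) , (λ I → q I ∘ s I)
        }
      ; reflexive = proj₁
      ; trans     = λ p q I → q I ∘ p I
      }
    ; antisym = _,_
    }
  }

private
  not-anti : ∀ a {b} → (a ≡ true → b ≡ true) → not b ≡ true → not a ≡ true
  not-anti false         p _ = refl
  not-anti true  {false} p _ = p refl

  ∧-mono : ∀ a b {c d} → (a ≡ true → c ≡ true) → (b ≡ true → d ≡ true) →
           a ∧ᵇ b ≡ true → c ∧ᵇ d ≡ true
  ∧-mono true true p q _ rewrite p refl | q refl = refl

  ∨-mono : ∀ a b {c d} → (a ≡ true → c ≡ true) → (b ≡ true → d ≡ true) →
           a ∨ᵇ b ≡ true → c ∨ᵇ d ≡ true
  ∨-mono true  b        p q _ rewrite p refl = refl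
  ∨-mono false true {c} p q _ rewrite q refl with c
  ... | true  = refl
  ... | false = refl

  ≤-not : ∀ {a b} → a ≤ᵇ b → not b ≤ᵇ not a
  ≤-not f≤t = f≤t
  ≤-not b≤b = b≤b

  ≤-∧ : ∀ {a b c d} → a ≤ᵇ c → b ≤ᵇ d → a ∧ᵇ b ≤ᵇ c ∧ᵇ d
  ≤-∧ {d = false}  f≤t q = b≤b
  ≤-∧ {d = true}   f≤t q = f≤t
  ≤-∧ {a = false}  b≤b q = b≤b
  ≤-∧ {a = true}   b≤b q = q

  ≤-∨ : ∀ {a b c d} → a ≤ᵇ c → b ≤ᵇ d → a ∨ᵇ b ≤ᵇ c ∨ᵇ d
  ≤-∨ {b = false}  f≤t q = f≤t
  ≤-∨ {b = true}   f≤t q = b≤b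
  ≤-∨ {a = false}  b≤b q = q
  ≤-∨ {a = true}   b≤b q = b≤b

-- Parameter symbols are Σp = Fin m, defined symbols are Σd = Fin n, and
-- Σ is their disjoint union.
module _ {m n : ℕ} where

  Σp Σd Σ : Set
  Σp = Fin m
  Σd = Fin n
  Σ  = Σp ⊎ Σd

  data Literal : Set where
    pos neg : Σ → Literal

  record Rule : Set where
    constructor _⟵_
    field
      head : Σd
      body : List Literal

  open Rule public

  literalFormula : Literal → Formula Σ
  literalFormula (pos a) = var a
  literalFormula (neg a) = ¬′ var a

  bodyFormula : Rule → Formula Σ
  bodyFormula r = ⋀ (map literalFormula (body r))

  Program : Set
  Program = List Rule

  -- φ_q
  definition : Program → Σd → Formula Σ
  definition P q = ⋁ (map bodyFormula (filter (λ r → head r ≟ q) P))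

  Lp Ldp : Poset 0ℓ 0ℓ 0ℓ
  Lp  = Lindenbaum Σp
  Ldp = pointwise Σd Lp

  module Symbolic = AFT Ldp

  SymbolicInterpretation : Set
  SymbolicInterpretation = Poset.Carrier Ldp

  -- φ^S for S = (Aₜ , Aₚ)
  symbolicValue : SymbolicInterpretation × SymbolicInterpretation →
                  Formula Σ → Formula Σp × Formula Σp
  symbolicValue S         (var (inj₁ p)) = var p , var p
  symbolicValue (Aₜ , Aₚ) (var (inj₂ q)) = Aₜ q , Aₚ q
  symbolicValue S         ⊤′             = ⊤′ , ⊤′
  symbolicValue S         ⊥′             = ⊥′ , ⊥′
  symbolicValue S         (¬′ φ)         =
    let (φₜ , φₚ) = symbolicValue S φ in ¬′ φₚ , ¬′ φₜ
  symbolicValue S         (φ ∧ ψ)        =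
    let (φₜ , φₚ) = symbolicValue S φ
        (ψₜ , ψₚ) = symbolicValue S ψ
    in φₜ ∧ ψₜ , φₚ ∧ ψₚ
  symbolicValue S         (φ ∨ ψ)        =
    let (φₜ , φₚ) = symbolicValue S φ
        (ψₜ , ψₚ) = symbolicValue S ψ
    in φₜ ∨ ψₜ , φₚ ∨ ψₚ

  private
    symbolicValue-mono : ∀ {S S′} → S Symbolic.≤ₚ S′ → ∀ φ →
      proj₁ (symbolicValue S φ) ⊩ proj₁ (symbolicValue S′ φ) ×
      proj₂ (symbolicValue S′ φ) ⊩ proj₂ (symbolicValue S φ)
    symbolicValue-mono S≤S′ (var (inj₁ p)) = (λ I → id) , (λ I → id)
    symbolicValue-mono S≤S′ (var (inj₂ q)) = proj₁ S≤S′ q , proj₂ S≤S′ q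
    symbolicValue-mono S≤S′ ⊤′             = (λ I → id) , (λ I → id)
    symbolicValue-mono S≤S′ ⊥′             = (λ I → id) , (λ I → id)
    symbolicValue-mono S≤S′ (¬′ φ) with symbolicValue-mono S≤S′ φ
    ... | p , q = (λ I → not-anti _ (q I)) , (λ I → not-anti _ (p I))
    symbolicValue-mono S≤S′ (φ ∧ ψ) with symbolicValue-mono S≤S′ φ | symbolicValue-mono S≤S′ ψ
    ... | p , q | r , s = (λ I → ∧-mono _ _ (p I) (r I)) , (λ I → ∧-mono _ _ (q I) (s I))
    symbolicValue-mono S≤S′ (φ ∨ ψ) with symbolicValue-mono S≤S′ φ | symbolicValue-mono S≤S′ ψ
    ... | p , q | r , s = (λ I → ∨-mono _ _ (p I) (r I)) , (λ I → ∨-mono _ _ (q I) (s I))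

    symbolicValue-exact : ∀ A φ →
      proj₂ (symbolicValue (A , A) φ) ≡ proj₁ (symbolicValue (A , A) φ)
    symbolicValue-exact A (var (inj₁ p)) = refl
    symbolicValue-exact A (var (inj₂ q)) = refl
    symbolicValue-exact A ⊤′             = refl
    symbolicValue-exact A ⊥′             = refl
    symbolicValue-exact A (¬′ φ)         = cong ¬′_ (sym (symbolicValue-exact A φ))
    symbolicValue-exact A (φ ∧ ψ)        =
      cong₂ _∧_ (symbolicValue-exact A φ) (symbolicValue-exact A ψ)
    symbolicValue-exact A (φ ∨ ψ)        =
      cong₂ _∨_ (symbolicValue-exact A φ) (symbolicValue-exact A ψ)

  -- 𝒯_P; the two components of φ_q^(A,A) coincide.
  symbolicT : Program → SymbolicInterpretation → SymbolicInterpretation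
  symbolicT P A q = proj₁ (symbolicValue (A , A) (definition P q))

  symbolicΨ : (P : Program) → Symbolic.Approximator (symbolicT P)
  symbolicΨ P = record
    { apply    = λ S → (λ q → proj₁ (symbolicValue S (definition P q))) ,
                       (λ q → proj₂ (symbolicValue S (definition P q)))
    ; monotone = λ S≤S′ → (λ q → proj₁ (symbolicValue-mono S≤S′ (definition P q))) ,
                          (λ q → proj₂ (symbolicValue-mono S≤S′ (definition P q)))
    ; exact    = λ A → (λ q → (λ I → id) , (λ I → id)) ,
                       (λ q → Poset.Eq.reflexive Lp (symbolicValue-exact A (definition P q)))
    }

  IsParametrisedWellFoundedModel :
    Program → SymbolicInterpretation × SymbolicInterpretation → Set
  IsParametrisedWellFoundedModel P = Symbolic.IsWellFounded (symbolicΨ P)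

  -- Every family A of formulas is a choice of representatives of its
  -- own classes.
  Th : SymbolicInterpretation → Formula Σ
  Th A = ⋀ (map (λ q → var (inj₂ q) ↔ rename inj₁ (A q)) (allFin n))

  2^Σd : Poset 0ℓ 0ℓ 0ℓ
  2^Σd = pointwise Σd Bool-poset

  module Concrete = AFT 2^Σd

  T⟨_⟩ : Interpretation Σp → Program → Interpretation Σd → Interpretation Σd
  T⟨ I ⟩ P K q = eval [ I , K ]′ (definition P q)

  -- Kleene's truth values are the pairs (true , true) for true,
  -- (false , true) for unknown, (false , false) for false;
  -- (true , false) is the inconsistent value of the full bilattice.
  kleeneValue : Interpretation Σp → Interpretation Σd × Interpretation Σd →
                Formula Σ → Bool × Bool
  kleeneValue I S         (var (inj₁ p)) = I p , I p
  kleeneValue I (Kₜ , Kₚ) (var (inj₂ q)) = Kₜ q , Kₚ q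
  kleeneValue I S         ⊤′             = true , true
  kleeneValue I S         ⊥′             = false , false
  kleeneValue I S         (¬′ φ)         =
    let (φₜ , φₚ) = kleeneValue I S φ in not φₚ , not φₜ
  kleeneValue I S         (φ ∧ ψ)        =
    let (φₜ , φₚ) = kleeneValue I S φ
        (ψₜ , ψₚ) = kleeneValue I S ψ
    in φₜ ∧ᵇ ψₜ , φₚ ∧ᵇ ψₚ
  kleeneValue I S         (φ ∨ ψ)        =
    let (φₜ , φₚ) = kleeneValue I S φ
        (ψₜ , ψₚ) = kleeneValue I S ψ
    in φₜ ∨ᵇ ψₜ , φₚ ∨ᵇ ψₚ

  private
    kleeneValue-mono : ∀ I {S S′} → S Concrete.≤ₚ S′ → ∀ φ →
      proj₁ (kleeneValue I S φ) ≤ᵇ proj₁ (kleeneValue I S′ φ) ×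
      proj₂ (kleeneValue I S′ φ) ≤ᵇ proj₂ (kleeneValue I S φ)
    kleeneValue-mono I S≤S′ (var (inj₁ p)) = b≤b , b≤b
    kleeneValue-mono I S≤S′ (var (inj₂ q)) = proj₁ S≤S′ q , proj₂ S≤S′ q
    kleeneValue-mono I S≤S′ ⊤′             = b≤b , b≤b
    kleeneValue-mono I S≤S′ ⊥′             = b≤b , b≤b
    kleeneValue-mono I S≤S′ (¬′ φ) with kleeneValue-mono I S≤S′ φ
    ... | p , q = ≤-not q , ≤-not p
    kleeneValue-mono I S≤S′ (φ ∧ ψ) with kleeneValue-mono I S≤S′ φ | kleeneValue-mono I S≤S′ ψ
    ... | p , q | r , s = ≤-∧ p r , ≤-∧ q s
    kleeneValue-mono I S≤S′ (φ ∨ ψ) with kleeneValue-mono I S≤S′ φ | kleeneValue-mono I S≤S′ ψ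
    ... | p , q | r , s = ≤-∨ p r , ≤-∨ q s

    kleeneValue-exact : ∀ I K φ →
      proj₁ (kleeneValue I (K , K) φ) ≡ eval [ I , K ]′ φ ×
      proj₂ (kleeneValue I (K , K) φ) ≡ eval [ I , K ]′ φ
    kleeneValue-exact I K (var (inj₁ p)) = refl , refl
    kleeneValue-exact I K (var (inj₂ q)) = refl , refl
    kleeneValue-exact I K ⊤′             = refl , refl
    kleeneValue-exact I K ⊥′             = refl , refl
    kleeneValue-exact I K (¬′ φ) with kleeneValue-exact I K φ
    ... | p , q = cong not q , cong not p
    kleeneValue-exact I K (φ ∧ ψ) with kleeneValue-exact I K φ | kleeneValue-exact I K ψ
    ... | p , q | r , s = cong₂ _∧ᵇ_ p r , cong₂ _∧ᵇ_ q s
    kleeneValue-exact I K (φ ∨ ψ) with kleeneValue-exact I K φ | kleeneValue-exact I K ψ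
    ... | p , q | r , s = cong₂ _∨ᵇ_ p r , cong₂ _∨ᵇ_ q s

  Ψ⟨_⟩ : (I : Interpretation Σp) (P : Program) → Concrete.Approximator (T⟨ I ⟩ P)
  Ψ⟨ I ⟩ P = record
    { apply    = λ S → (λ q → proj₁ (kleeneValue I S (definition P q))) ,
                       (λ q → proj₂ (kleeneValue I S (definition P q)))
    ; monotone = λ S≤S′ → (λ q → proj₁ (kleeneValue-mono I S≤S′ (definition P q))) ,
                          (λ q → proj₂ (kleeneValue-mono I S≤S′ (definition P q)))
    ; exact    = λ K → (λ q → proj₁ (kleeneValue-exact I K (definition P q))) ,
                       (λ q → proj₂ (kleeneValue-exact I K (definition P q)))
    }

  infix 4 _⊨wf_

  -- J ∘ inj₁ and J ∘ inj₂ are J ∩ Σp and J ∩ Σd.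
  _⊨wf_ : Interpretation Σ → Program → Set
  J ⊨wf P = Concrete.IsWellFounded (Ψ⟨ J ∘ inj₁ ⟩ P) (J ∘ inj₂ , J ∘ inj₂)

{-# OPTIONS --safe #-}

-- For a fixed parameter interpretation I, evaluation at I maps symbolic to
-- classical interpretations and commutes with the two approximators.
-- Conversely, since Σp is finite, I is described by a formula χ I, so an
-- arbitrary classical interpretation can be spliced into a symbolic one at I
-- without changing it at any other I′.  Splicing turns each classical
-- competitor (fixpoint or partial stable fixpoint) into a symbolic one, so
-- leastness passes from the symbolic to the classical side and the
-- parametrised well-founded model evaluates at I to the well-founded model
-- of P under I.
module Submission where

open import Defs
open import Data.Bool.Base using (Bool; true; false; not; f≤t; b≤b) renaming (_∧_ to _∧ᵇ_; _∨_ to _∨ᵇ_; _≤_ to _≤ᵇ_)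
open import Data.Bool.Properties using (∨-identityʳ; ≤-antisym)
open import Data.Fin.Base using (Fin)
open import Data.List.Base using ([]; _∷_; map; allFin)
open import Data.List.Relation.Unary.All using (All; []; _∷_)
open import Data.List.Relation.Unary.All.Properties using (map⁺; map⁻; tabulate⁺; tabulate⁻)
open import Data.Nat.Base using (ℕ)
open import Data.Product.Base using (_×_; _,_; proj₁; proj₂; ∃; ∃₂)
open import Data.Sum.Base using (_⊎_; inj₁; inj₂)
open import Function.Base using (_∘_)
open import Function.Bundles using (_⇔_; mk⇔)
open import Relation.Binary.PropositionalEquality using (_≡_; _≗_; refl; sym; trans; cong; cong₂; subst₂)

≤⇒implies : ∀ {a b} → a ≤ᵇ b → a ≡ true → b ≡ true
≤⇒implies b≤b p = p

implies⇒≤ : ∀ {a b} → (a ≡ true → b ≡ true) → a ≤ᵇ b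
implies⇒≤ {false} {false} p = b≤b
implies⇒≤ {false} {true}  p = f≤t
implies⇒≤ {true}          p rewrite p refl = b≤b

module _ {A : Set} (I : Interpretation A) where

  ⋀⁺ : ∀ {φs} → All (I ⊨_) φs → I ⊨ ⋀ φs
  ⋀⁺ []       = refl
  ⋀⁺ (p ∷ ps) rewrite p = ⋀⁺ ps

  ⋀⁻ : ∀ φs → I ⊨ ⋀ φs → All (I ⊨_) φs
  ⋀⁻ []       _ = []
  ⋀⁻ (φ ∷ φs) p with eval I φ in eq
  ... | true = eq ∷ ⋀⁻ φs p

  ↔⁺ : ∀ φ ψ → eval I φ ≡ eval I ψ → I ⊨ (φ ↔ ψ)
  ↔⁺ φ ψ p rewrite p with eval I ψ
  ... | true  = refl
  ... | false = refl

  ↔⁻ : ∀ φ ψ → I ⊨ (φ ↔ ψ) → eval I φ ≡ eval I ψ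
  ↔⁻ φ ψ p with eval I φ | eval I ψ
  ... | true  | true  = refl
  ... | false | false = refl

  ⋀-↔⁺ : ∀ {k} (φ ψ : Fin k → Formula A) → eval I ∘ φ ≗ eval I ∘ ψ →
         I ⊨ ⋀ (map (λ i → φ i ↔ ψ i) (allFin k))
  ⋀-↔⁺ φ ψ p = ⋀⁺ (map⁺ (tabulate⁺ λ i → ↔⁺ (φ i) (ψ i) (p i)))

  ⋀-↔⁻ : ∀ {k} (φ ψ : Fin k → Formula A) →
         I ⊨ ⋀ (map (λ i → φ i ↔ ψ i) (allFin k)) → eval I ∘ φ ≗ eval I ∘ ψ
  ⋀-↔⁻ φ ψ p i = ↔⁻ (φ i) (ψ i) (tabulate⁻ (map⁻ (⋀⁻ _ p)) i)

  ≈⇒eval : ∀ φ ψ → φ ⊩ ψ × ψ ⊩ φ → eval I φ ≡ eval I ψ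
  ≈⇒eval φ ψ (p , q) = ≤-antisym (implies⇒≤ (p I)) (implies⇒≤ (q I))

eval⇒≈ : ∀ {A} (φ ψ : Formula A) → (∀ I → eval I φ ≡ eval I ψ) → φ ⊩ ψ × ψ ⊩ φ
eval⇒≈ φ ψ p = (λ I → trans (sym (p I))) , (λ I → trans (p I))

eval-cong : ∀ {A} {I I′ : Interpretation A} → I ≗ I′ → eval I ≗ eval I′
eval-cong e (var a) = e a
eval-cong e ⊤′      = refl
eval-cong e ⊥′      = refl
eval-cong e (¬′ φ)  = cong not (eval-cong e φ)
eval-cong e (φ ∧ ψ) = cong₂ _∧ᵇ_ (eval-cong e φ) (eval-cong e ψ)
eval-cong e (φ ∨ ψ) = cong₂ _∨ᵇ_ (eval-cong e φ) (eval-cong e ψ)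

eval-rename : ∀ {A B} (f : A → B) J φ → eval J (rename f φ) ≡ eval (J ∘ f) φ
eval-rename f J (var a) = refl
eval-rename f J ⊤′      = refl
eval-rename f J ⊥′      = refl
eval-rename f J (¬′ φ)  = cong not (eval-rename f J φ)
eval-rename f J (φ ∧ ψ) = cong₂ _∧ᵇ_ (eval-rename f J φ) (eval-rename f J ψ)
eval-rename f J (φ ∨ ψ) = cong₂ _∨ᵇ_ (eval-rename f J φ) (eval-rename f J ψ)

constant : ∀ {A} → Bool → Formula A
constant true  = ⊤′
constant false = ⊥′

eval-constant : ∀ {A} (I : Interpretation A) b → eval I (constant b) ≡ b
eval-constant I true  = refl
eval-constant I false = refl

module _ {k : ℕ} where

  -- The minterm of `I`, written with biconditionals rather than literals so that the lemmas serving
  -- `Th` apply to it as well.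
  χ : Interpretation (Fin k) → Formula (Fin k)
  χ I = ⋀ (map (λ p → var p ↔ constant (I p)) (allFin k))

  χ⁺ : ∀ I → I ⊨ χ I
  χ⁺ I = ⋀-↔⁺ I var (constant ∘ I) λ p → sym (eval-constant I (I p))

  χ⁻ : ∀ I I′ → I′ ⊨ χ I → I′ ≗ I
  χ⁻ I I′ e p = trans (⋀-↔⁻ I′ var (constant ∘ I) e p) (eval-constant I′ (I p))

module _ {m n : ℕ} where

  private
    Param = Interpretation (Fin m)
    Sym   = Fin n → Formula (Fin m)
    Int   = Interpretation (Fin n)

    module S = Symbolic {m} {n}
    module C = Concrete {m} {n}

  Represents : Param → Sym → Int → Set
  Represents I A K = ∀ q → eval I (A q) ≡ K q

  -- Evaluation at `I` intertwines `f` with `g`. Letting `K` be any function represented by `A`, not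
  -- only `eval I ∘ A`, makes `g` respect pointwise equality.
  Simulates : Param → (Sym → Sym) → (Int → Int) → Set
  Simulates I f g = ∀ A {K} → Represents I A K → Represents I (f A) (g K)

  splice : Param → Int → Sym → Sym
  splice I K A q = (χ I ∧ constant (K q)) ∨ (¬′ χ I ∧ A q)

  splice-at : ∀ I K A → Represents I (splice I K A) K
  splice-at I K A q rewrite χ⁺ I =
    trans (∨-identityʳ _) (eval-constant I (K q))

  -- When `χ I` fails at `I′`, the splice reduces to its old value. `K` and `A` are quantified
  -- inside each alternative so that one case split serves both components of a pair.
  splice-cases : ∀ I I′ →
    (I′ ≗ I × ∀ K A → Represents I′ (splice I K A) K) ⊎
    (∀ K A → Represents I′ (splice I K A) (eval I′ ∘ A))
  splice-cases I I′ with eval I′ (χ I) in e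
  ... | true  = inj₁ (χ⁻ I I′ e , λ K A q → trans (∨-identityʳ _) (eval-constant I′ (K q)))
  ... | false = inj₂ λ K A q → refl

  represents-resp : ∀ {I I′ K} A → I′ ≗ I → Represents I A K → Represents I′ A K
  represents-resp A e r q = trans (eval-cong e (A q)) (r q)

  -- Without function extensionality, parameter interpretations that agree
  -- pointwise must be allowed to differ.
  symbolicValue-represents : ∀ {I I′ Aₜ Aₚ Kₜ Kₚ} → I′ ≗ I →
    Represents I′ Aₜ Kₜ → Represents I′ Aₚ Kₚ → (φ : Formula (Σ {m} {n})) →
    eval I′ (proj₁ (symbolicValue (Aₜ , Aₚ) φ)) ≡ proj₁ (kleeneValue I (Kₜ , Kₚ) φ) ×
    eval I′ (proj₂ (symbolicValue (Aₜ , Aₚ) φ)) ≡ proj₂ (kleeneValue I (Kₜ , Kₚ) φ)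
  symbolicValue-represents e t p (var (inj₁ a)) = e a , e a
  symbolicValue-represents e t p (var (inj₂ q)) = t q , p q
  symbolicValue-represents e t p ⊤′ = refl , refl
  symbolicValue-represents e t p ⊥′ = refl , refl
  symbolicValue-represents e t p (¬′ φ) with symbolicValue-represents e t p φ
  ... | a , b = cong not b , cong not a
  symbolicValue-represents e t p (φ ∧ ψ)
    with symbolicValue-represents e t p φ | symbolicValue-represents e t p ψ
  ... | a , b | c , d = cong₂ _∧ᵇ_ a c , cong₂ _∧ᵇ_ b d
  symbolicValue-represents e t p (φ ∨ ψ)
    with symbolicValue-represents e t p φ | symbolicValue-represents e t p ψ
  ... | a , b | c , d = cong₂ _∨ᵇ_ a c , cong₂ _∨ᵇ_ b d

  -- A classical fixpoint `z` of `g`, spliced into `X` at `I`, becomes a symbolic competitor of `X`;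
  -- comparing the two at `I` puts `K` below `z`. The first hypothesis makes the value of `f A` at
  -- `I′` depend only on the values of `A` at `I′`.
  lfp-at : ∀ f X {g I K} →
    (∀ I′ → ∃ (Simulates I′ f)) → (∀ {I′} → I′ ≗ I → Simulates I′ f g) →
    Represents I X K → S.IsLfp f X → C.IsLfp g K
  lfp-at f X {g} {I} {K} local sim r (fix , least) = fixK , leastK
    where
    fixK : g K ≗ K
    fixK q = trans (sym (sim (λ _ → refl) X r q)) (trans (≈⇒eval I (f X q) (X q) (fix q)) (r q))

    leastK : ∀ z → g z ≗ z → ∀ q → K q ≤ᵇ z q
    leastK z gz q =
      subst₂ _≤ᵇ_ (r q) (splice-at I z X q)
        (implies⇒≤ (least Z (λ q′ → eval⇒≈ (f Z q′) (Z q′) λ I′ → fixZ I′ q′) q I))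
      where
      Z : Sym
      Z = splice I z X

      fixZ : ∀ I′ q → eval I′ (f Z q) ≡ eval I′ (Z q)
      fixZ I′ q with splice-cases I I′
      ... | inj₁ (e , s) = trans (sim e Z (s z X) q) (trans (gz q) (sym (s z X q)))
      -- `Z` and `X` have the same values at `I′`, hence so do `f Z` and `f X`, and `X` is already a
      -- fixpoint there.
      ... | inj₂ s = let _ , sim′ = local I′ in
        trans (sim′ Z (s z X) q)
          (trans (sym (sim′ X (λ _ → refl) q))
            (trans (≈⇒eval I′ (f X q) (X q) (fix q)) (sym (s z X q))))

  -- Entailment is tested at each `I` separately, and there any symbolic fixpoint `Z` evaluates to a
  -- fixpoint of the local `g`, hence lies above the local least one.
  lfp-glue : ∀ f X →
    (∀ I → ∃₂ λ g K → Simulates I f g × Represents I X K × C.IsLfp g K) → S.IsLfp f X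
  lfp-glue f X loc = (λ q → eval⇒≈ (f X q) (X q) λ I → fixX I q) , leastX
    where
    fixX : ∀ I q → eval I (f X q) ≡ eval I (X q)
    fixX I q with loc I
    ... | g , K , sim , r , fix , _ = trans (sim X r q) (trans (fix q) (sym (r q)))

    leastX : ∀ Z → (∀ q → f Z q ⊩ Z q × Z q ⊩ f Z q) → ∀ q → X q ⊩ Z q
    leastX Z fixZ q I with loc I
    ... | g , K , sim , r , _ , least =
      ≤⇒implies (least (eval I ∘ Z) fixEval q) ∘ trans (sym (r q))
      where
      fixEval : g (eval I ∘ Z) ≗ eval I ∘ Z
      fixEval q′ = trans (sym (sim Z (λ _ → refl) q′)) (≈⇒eval I (f Z q′) (Z q′) (fixZ q′))

  module _ (P : Program {m} {n}) where

    private
      module Ψˢ = S.Approximator (symbolicΨ P)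
      module Ψᶜ I = C.Approximator (Ψ⟨_⟩ {m} {n} I P)

      lower upper : Sym → Sym → Sym
      lower Y Z = proj₁ (Ψˢ.apply (Z , Y))
      upper X Z = proj₂ (Ψˢ.apply (X , Z))

    lower-simulates : ∀ Y {I I′ y} → I′ ≗ I → Represents I′ Y y →
      Simulates I′ (lower Y) (λ z → proj₁ (Ψᶜ.apply I (z , y)))
    lower-simulates Y e rY Z rZ q =
      proj₁ (symbolicValue-represents {Aₜ = Z} {Y} e rZ rY (definition P q))

    upper-simulates : ∀ X {I I′ x} → I′ ≗ I → Represents I′ X x →
      Simulates I′ (upper X) (λ z → proj₂ (Ψᶜ.apply I (x , z)))
    upper-simulates X e rX Z rZ q =
      proj₂ (symbolicValue-represents {Aₜ = X} {Z} e rX rZ (definition P q))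

    stable-at : ∀ X Y {I x y} → Represents I X x → Represents I Y y →
      S.IsPartialStable (symbolicΨ P) (X , Y) → C.IsPartialStable (Ψ⟨_⟩ {m} {n} I P) (x , y)
    stable-at X Y rX rY (lfpX , lfpY) =
      lfp-at (lower Y) X (λ I′ → _ , lower-simulates Y {I′} (λ _ → refl) (λ _ → refl))
             (λ e → lower-simulates Y e (represents-resp Y e rY)) rX lfpX ,
      lfp-at (upper X) Y (λ I′ → _ , upper-simulates X {I′} (λ _ → refl) (λ _ → refl))
             (λ e → upper-simulates X e (represents-resp X e rX)) rY lfpY

    -- The operator is indexed by some `I` agreeing with `I′`, not by `I′` itself: a classical
    -- competitor is stable for one given index, and satisfying `χ I` yields pointwise agreement
    -- only.
    StableAt : Sym → Sym → Param → Set
    StableAt X Y I′ = ∃ λ I → ∃₂ λ x y →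
      I′ ≗ I × Represents I′ X x × Represents I′ Y y ×
      C.IsPartialStable (Ψ⟨_⟩ {m} {n} I P) (x , y)

    stable-glue : ∀ X Y → (∀ I → StableAt X Y I) → S.IsPartialStable (symbolicΨ P) (X , Y)
    stable-glue X Y loc =
      lfp-glue (lower Y) X (λ I′ → let I , x , y , e , rX , rY , lfpx , _ = loc I′ in
        _ , x , lower-simulates Y e rY , rX , lfpx) ,
      lfp-glue (upper X) Y (λ I′ → let I , x , y , e , rX , rY , _ , lfpy = loc I′ in
        _ , y , upper-simulates X e rX , rY , lfpy)

    -- A rival `(u , v)` stable at `I` is spliced into `(X , Y)` in both components. The result is
    -- stable at every `I′`, hence symbolically, so `(X , Y)` lies below it in precision; this is
    -- then evaluated at `I`.
    wellFounded-at : ∀ X Y {I x y} → Represents I X x → Represents I Y y →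
      S.IsWellFounded (symbolicΨ P) (X , Y) → C.IsWellFounded (Ψ⟨_⟩ {m} {n} I P) (x , y)
    wellFounded-at X Y {I} {x} {y} rX rY (stable , least) = stable-at X Y rX rY stable , least′
      where
      least′ : ∀ s → C.IsPartialStable (Ψ⟨_⟩ {m} {n} I P) s → (x , y) C.≤ₚ s
      least′ (u , v) stable′ =
        (λ q → subst₂ _≤ᵇ_ (rX q) (splice-at I u X q) (implies⇒≤ (proj₁ below q I))) ,
        (λ q → subst₂ _≤ᵇ_ (splice-at I v Y q) (rY q) (implies⇒≤ (proj₂ below q I)))
        where
        spliced : S.IsPartialStable (symbolicΨ P) (splice I u X , splice I v Y)
        spliced = stable-glue _ _ loc
          where
          loc : ∀ I′ → StableAt (splice I u X) (splice I v Y) I′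
          loc I′ with splice-cases I I′
          ... | inj₁ (e , s) = I , u , v , e , s u X , s v Y , stable′
          -- Here the rival is invisible, and stability is inherited from `(X , Y)`.
          ... | inj₂ s = I′ , _ , _ , (λ _ → refl) , s u X , s v Y ,
            stable-at X Y (λ _ → refl) (λ _ → refl) stable

        below : (X , Y) S.≤ₚ (splice I u X , splice I v Y)
        below = least _ spliced

theorem4p11 : (m n : ℕ) (P : Program {m} {n}) (A : SymbolicInterpretation {m} {n}) →
    IsParametrisedWellFoundedModel P (A , A) →
    (J : Interpretation (Σ {m} {n})) → (J ⊨wf P) ⇔ (J ⊨ Th A)
theorem4p11 m n P A wf J = mk⇔ to from
  where
  I : Interpretation (Fin m)
  I = J ∘ inj₁

  to : J ⊨wf P → J ⊨ Th A
  to (stable , least) =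
    let evalStable , evalLeast = wellFounded-at P A A {I} (λ _ → refl) (λ _ → refl) wf
        -- `J` on the defined symbols and `A` evaluated at `I` both give least precise stable pairs,
        -- so each pair lies below the other; the first components give inclusion both ways.
        J≤A = proj₁ (least _ evalStable)
        A≤J = proj₁ (evalLeast _ stable)
    in ⋀-↔⁺ J (var ∘ inj₂) (rename inj₁ ∘ A) λ q →
         trans (≤-antisym (J≤A q) (A≤J q)) (sym (eval-rename inj₁ J (A q)))

  from : J ⊨ Th A → J ⊨wf P
  from J⊨Th = wellFounded-at P A A represents represents wf
    where
    represents : Represents I A (J ∘ inj₂)
    represents q = trans (sym (eval-rename inj₁ J (A q)))
      (sym (⋀-↔⁻ J (var ∘ inj₂) (rename inj₁ ∘ A) J⊨Th q))
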